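{- Let $S=\{s_1,s_2\}$ be a set of two distinct nonempty binary strings. The Seeker wins the Renyi-Ulam game with lie restriction $r(S)$ if and only if at least one of the following holds: (a) $S$ contains one of the strings $0$, $1$, $01$, $10$ (equivalently, some element of $S$ is a substring of one of $0,1,01,10$); (b) $S$ is one of the following 28 sets: $\{000,101\}$, $\{000,1011\}$, $\{000,1101\}$; $\{010,111\}$, $\{010,0011\}$, $\{010,0111\}$, $\{010,1100\}$, $\{010,1110\}$, $\{010,00111\}$, $\{010,11100\}$; $\{101,0001\}$, $\{101,0011\}$, $\{101,1000\}$, $\{101,1100\}$, $\{101,00011\}$, $\{101,11000\}$; $\{111,0010\}$, $\{111,0100\}$; $\{0001,1011\}$, $\{0001,1101\}$, $\{0010,0111\}$, $\{0010,1110\}$, $\{0011,0101\}$, $\{0100,0111\}$, $\{0100,1110\}$, $\{1000,1011\}$, $\{1000,1101\}$, $\{1010,1100\}$; (c) $S=\{s_1,s_2\}$ with $s_1\in\{00,001,100\}$ and $s_2\in R_\#$, or with $s_1\in\{11,011,110\}$ and $s_2\in R_\#^{inv}$.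
   Context: For a set $S$ of nonempty binary strings, $r(S)$ is the set of all finite binary strings that contain no element of $S$ as a contiguous substring. Renyi-Ulam game with lie restriction $R$ (a set of binary strings): the Obscurer picks $x\in\{1,\dots,n\}$; on each turn the Seeker asks whether $x$ lies in a chosen subset of $\{1,\dots,n\}$ and the Obscurer answers yes or no. For a candidate $y\in\{1,\dots,n\}$, its lie pattern is the binary string whose $i$-th bit is $1$ if the $i$-th answer is false for $y$ and $0$ if it is true. The Obscurer's answers must be such that the lie pattern of her number lies in $R$ after every answer. The Seeker wins for $n$ if he has an adaptive strategy which, after finitely many questions, guarantees that at most one $y\in\{1,\dots,n\}$ has its lie pattern in $R$. "The Seeker wins" (for $R$) means he wins for every $n\ge1$; otherwise the Obscurer wins. $R_\#$ is the set of binary strings containing no substring of the form $01^k0$ with $k=0$ or $k\ge2$; explicitly $R_\#=\{1^a w 1^c: a,c\ge0,\ w \text{ empty or } w=(01)^j0 \text{ for some } j\ge0\}$. $R_\#^{inv}$ is obtained from $R_\#$ by swapping $0$ and $1$ in every string. -}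

module Defs where

open import Data.Nat using (ℕ; zero; suc; _≤_)
open import Data.Fin using (Fin)
open import Data.List using (List; []; _∷_; _++_; replicate; map)
open import Data.List.Relation.Unary.All using (All)
open import Data.List.Membership.Propositional using (_∈_)
open import Data.Product using (_×_; _,_; ∃)
open import Data.Sum using (_⊎_)
open import Relation.Nullary using (¬_)
open import Relation.Binary.PropositionalEquality using (_≡_)

data Bit : Set where
  b0 b1 : Bit

Str : Set
Str = List Bit

flipBit : Bit → Bit
flipBit b0 = b1
flipBit b1 = b0

Sub : Str → Str → Set
Sub u w = ∃ λ p → ∃ λ q → p ++ (u ++ q) ≡ w

r : List Str → Str → Set
r S w = All (λ s → ¬ Sub s w) S

-- Rényi–Ulam game.  A position records, for each candidate y ∈ Fin n
-- (representing {1,…,n}), its lie pattern so far.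
-- Answering 'a' to the question "is x ∈ Q?" appends to the pattern of y
-- the bit 1 if the answer is false for y (a ≠ Q y) and 0 otherwise.
lieBit : Bit → Bit → Bit
lieBit b0 b0 = b0
lieBit b1 b1 = b0
lieBit b0 b1 = b1
lieBit b1 b0 = b1

-- answer bit: b1 = "yes", b0 = "no"; question Q : Fin n → Bit (b1 = member)
step : ∀ {n} → (Fin n → Str) → (Fin n → Bit) → Bit → (Fin n → Str)
step st Q a y = st y ++ (lieBit a (Q y) ∷ [])

AtMostOne : ∀ {n} → (Str → Set) → (Fin n → Str) → Set
AtMostOne {n} R st = (y z : Fin n) → R (st y) → R (st z) → y ≡ z

-- Seeker has a (finite, adaptive) winning strategy from position st.
-- The Seeker must handle both answers; an answer for which no candidate
-- remains consistent leads to a position where 'done' applies trivially.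
data Wins (R : Str → Set) {n : ℕ} : (Fin n → Str) → Set where
  done : ∀ {st} → AtMostOne R st → Wins R st
  ask  : ∀ {st} (Q : Fin n → Bit) → ((a : Bit) → Wins R (step st Q a)) → Wins R st

SeekerWinsFor : (Str → Set) → ℕ → Set
SeekerWinsFor R n = Wins R {n} (λ _ → [])

SeekerWins : (Str → Set) → Set
SeekerWins R = (n : ℕ) → 1 ≤ n → SeekerWinsFor R n

R# : Str → Set
R# w = (k : ℕ) → (k ≡ 0 ⊎ 2 ≤ k) → ¬ Sub (b0 ∷ (replicate k b1 ++ (b0 ∷ []))) w

R#inv : Str → Set
R#inv w = R# (map flipBit w)

shortList : List Str
shortList = (b0 ∷ []) ∷ (b1 ∷ []) ∷ (b0 ∷ b1 ∷ []) ∷ (b1 ∷ b0 ∷ []) ∷ []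

CondA : Str → Str → Set
CondA s₁ s₂ = s₁ ∈ shortList ⊎ s₂ ∈ shortList

private
  _,,_ : Str → Str → Str × Str
  _,,_ = _,_
  infixr 4 _,,_
  O I : Bit
  O = b0
  I = b1

exceptional : List (Str × Str)
exceptional =
  ((O ∷ O ∷ O ∷ []) ,, (I ∷ O ∷ I ∷ [])) ∷
  ((O ∷ O ∷ O ∷ []) ,, (I ∷ O ∷ I ∷ I ∷ [])) ∷
  ((O ∷ O ∷ O ∷ []) ,, (I ∷ I ∷ O ∷ I ∷ [])) ∷
  ((O ∷ I ∷ O ∷ []) ,, (I ∷ I ∷ I ∷ [])) ∷
  ((O ∷ I ∷ O ∷ []) ,, (O ∷ O ∷ I ∷ I ∷ [])) ∷
  ((O ∷ I ∷ O ∷ []) ,, (O ∷ I ∷ I ∷ I ∷ [])) ∷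
  ((O ∷ I ∷ O ∷ []) ,, (I ∷ I ∷ O ∷ O ∷ [])) ∷
  ((O ∷ I ∷ O ∷ []) ,, (I ∷ I ∷ I ∷ O ∷ [])) ∷
  ((O ∷ I ∷ O ∷ []) ,, (O ∷ O ∷ I ∷ I ∷ I ∷ [])) ∷
  ((O ∷ I ∷ O ∷ []) ,, (I ∷ I ∷ I ∷ O ∷ O ∷ [])) ∷
  ((I ∷ O ∷ I ∷ []) ,, (O ∷ O ∷ O ∷ I ∷ [])) ∷
  ((I ∷ O ∷ I ∷ []) ,, (O ∷ O ∷ I ∷ I ∷ [])) ∷
  ((I ∷ O ∷ I ∷ []) ,, (I ∷ O ∷ O ∷ O ∷ [])) ∷
  ((I ∷ O ∷ I ∷ []) ,, (I ∷ I ∷ O ∷ O ∷ [])) ∷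
  ((I ∷ O ∷ I ∷ []) ,, (O ∷ O ∷ O ∷ I ∷ I ∷ [])) ∷
  ((I ∷ O ∷ I ∷ []) ,, (I ∷ I ∷ O ∷ O ∷ O ∷ [])) ∷
  ((I ∷ I ∷ I ∷ []) ,, (O ∷ O ∷ I ∷ O ∷ [])) ∷
  ((I ∷ I ∷ I ∷ []) ,, (O ∷ I ∷ O ∷ O ∷ [])) ∷
  ((O ∷ O ∷ O ∷ I ∷ []) ,, (I ∷ O ∷ I ∷ I ∷ [])) ∷
  ((O ∷ O ∷ O ∷ I ∷ []) ,, (I ∷ I ∷ O ∷ I ∷ [])) ∷
  ((O ∷ O ∷ I ∷ O ∷ []) ,, (O ∷ I ∷ I ∷ I ∷ [])) ∷
  ((O ∷ O ∷ I ∷ O ∷ []) ,, (I ∷ I ∷ I ∷ O ∷ [])) ∷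
  ((O ∷ O ∷ I ∷ I ∷ []) ,, (O ∷ I ∷ O ∷ I ∷ [])) ∷
  ((O ∷ I ∷ O ∷ O ∷ []) ,, (O ∷ I ∷ I ∷ I ∷ [])) ∷
  ((O ∷ I ∷ O ∷ O ∷ []) ,, (I ∷ I ∷ I ∷ O ∷ [])) ∷
  ((I ∷ O ∷ O ∷ O ∷ []) ,, (I ∷ O ∷ I ∷ I ∷ [])) ∷
  ((I ∷ O ∷ O ∷ O ∷ []) ,, (I ∷ I ∷ O ∷ I ∷ [])) ∷
  ((I ∷ O ∷ I ∷ O ∷ []) ,, (I ∷ I ∷ O ∷ O ∷ [])) ∷
  []

CondB : Str → Str → Set
CondB s₁ s₂ = (s₁ , s₂) ∈ exceptional ⊎ (s₂ , s₁) ∈ exceptional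

zeroList oneList : List Str
zeroList = (b0 ∷ b0 ∷ []) ∷ (b0 ∷ b0 ∷ b1 ∷ []) ∷ (b1 ∷ b0 ∷ b0 ∷ []) ∷ []
oneList  = (b1 ∷ b1 ∷ []) ∷ (b1 ∷ b1 ∷ b0 ∷ []) ∷ (b0 ∷ b1 ∷ b1 ∷ []) ∷ []

CondCOrdered : Str → Str → Set
CondCOrdered u v = (u ∈ zeroList × R# v) ⊎ (u ∈ oneList × R#inv v)

CondC : Str → Str → Set
CondC s₁ s₂ = CondCOrdered s₁ s₂ ⊎ CondCOrdered s₂ s₁

{-# OPTIONS --safe #-}

-- Forbidding factors makes the game depend on two candidates only: a two-candidate strategy,
-- played from any position with one candidate against all the others, eliminates a side, because a
-- forbidden factor in the bits added since then is fatal whatever came before.  With two words, the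
-- Seeker's finite cases are bounded searches, and in case (c) he forces any word of R# by threatening
-- to create the factor 00, after which a candidate has no freedom left.  The Obscurer survives on
-- {00, 01ᵏ0}, k ≥ 2, by keeping the distances to the last 0 different.  For the other minimal losing pairs
-- of the Seeker she stays in a closed set of pairs of Aho–Corasick states.  All remaining
-- pairs of words contain one of these minimal pairs, already within their prefixes of length six.

module Submission where

open import Defs
open import Data.Bool using (if_then_else_)
open import Data.Fin using (Fin; zero; suc)
import Data.Fin.Properties as Fin
open import Data.List using (List; []; _∷_; _++_; _∷ʳ_; map; reverse; replicate; filter; inits;
  concatMap; cartesianProduct; deduplicate; foldl; allFin; initLast; InitLast; _∷ʳ′_)
open import Data.List.Properties using (reverse-++; reverse-involutive;
  unfold-reverse; ++-assoc; ++-identityʳ; ++-conicalˡ; ++-conicalʳ;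
  ∷ʳ-injective; ∷ʳ-injectiveˡ; map-++; foldl-++; foldl-∷ʳ; ≡-dec)
open import Data.List.Membership.Propositional using (_∈_; find)
open import Data.List.Membership.Propositional.Properties using (∈-allFin; ∈-++⁻)
import Data.List.Relation.Unary.Any.Properties as Any
import Data.List.Membership.DecPropositional as DecMembership
open import Data.List.Relation.Unary.All as All using (All; []; _∷_; all?)
open import Data.List.Relation.Unary.Any as Any using (Any; here; there; any?)
open import Data.Nat using (ℕ; zero; suc; _+_; _≤_; _<_; s≤s; z≤n)
import Data.Nat.Properties as ℕ
open import Data.Product using (_×_; _,_; ∃; proj₁; proj₂)
open import Data.Product.Properties using () renaming (≡-dec to ×-≡-dec)
open import Data.Sum as Sum using (_⊎_; inj₁; inj₂; [_,_]′)
open import Data.Unit using (⊤; tt)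
open import Function.Base using (_∘_)
open import Function.Bundles using (_⇔_; mk⇔)
open import Relation.Binary.Definitions using (DecidableEquality)
open import Relation.Binary.PropositionalEquality
open import Relation.Nullary using (¬_; Dec; yes; no; does; contradiction)
open import Relation.Nullary.Decidable using (map′; _×-dec_; _⊎-dec_; ¬?; from-yes)

-- Factors

_≟ᵇ_ : DecidableEquality Bit
b0 ≟ᵇ b0 = yes refl
b0 ≟ᵇ b1 = no λ ()
b1 ≟ᵇ b0 = no λ ()
b1 ≟ᵇ b1 = yes refl

_≟ˢ_ : DecidableEquality Str
_≟ˢ_ = ≡-dec _≟ᵇ_

Prefix Suffix : Str → Str → Set
Prefix p w = ∃ λ q → p ++ q ≡ w
Suffix p w = ∃ λ q → q ++ p ≡ w

prefix? : ∀ p w → Dec (Prefix p w)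
prefix? [] w = yes (w , refl)
prefix? (x ∷ p) [] = no λ ()
prefix? (x ∷ p) (y ∷ w) =
  map′ (λ { (refl , q , refl) → q , refl }) (λ { (q , refl) → refl , q , refl })
       ((x ≟ᵇ y) ×-dec prefix? p w)

suffix? : ∀ p w → Dec (Suffix p w)
suffix? p [] = map′ ([] ,_) (λ { (q , e) → ++-conicalʳ q p e }) (p ≟ˢ [])
suffix? p (y ∷ w) =
  map′ (λ { (inj₁ e) → [] , e ; (inj₂ (q , e)) → y ∷ q , cong (y ∷_) e })
       (λ { ([] , e) → inj₁ e ; (_ ∷ q , refl) → inj₂ (q , refl) })
       ((p ≟ˢ (y ∷ w)) ⊎-dec suffix? p w)

sub? : ∀ s w → Dec (Sub s w)
sub? s [] = map′ (λ { (q , e) → [] , q , e })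
                 (λ { ([] , q , e) → q , e }) (prefix? s [])
sub? s (y ∷ w) =
  map′ (λ { (inj₁ (q , e)) → [] , q , e ; (inj₂ (p , q , e)) → y ∷ p , q , cong (y ∷_) e })
       (λ { ([] , q , e) → inj₁ (q , e) ; (_ ∷ p , q , refl) → inj₂ (p , q , refl) })
       (prefix? s (y ∷ w) ⊎-dec sub? s w)

sub-refl : ∀ {s} → Sub s s
sub-refl {s} = [] , [] , ++-identityʳ s

sub-trans : ∀ {s t w} → Sub s t → Sub t w → Sub s w
sub-trans {s} (p , q , refl) (p′ , q′ , refl) = p′ ++ p , q ++ q′ ,
  trans (++-assoc p′ p _)
    (cong (p′ ++_) (sym (trans (++-assoc p (s ++ q) q′) (cong (p ++_) (++-assoc s q q′)))))

prefix⇒sub : ∀ {s w} → Prefix s w → Sub s w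
prefix⇒sub (q , e) = [] , q , e

suffix⇒sub : ∀ {s w} → Suffix s w → Sub s w
suffix⇒sub {s} (q , e) = q , [] , trans (cong (q ++_) (++-identityʳ s)) e

suffix-[] : ∀ {w} → Suffix [] w
suffix-[] {w} = w , ++-identityʳ w

suffix-∷ʳ⁺ : ∀ {p w} b → Suffix p w → Suffix (p ∷ʳ b) (w ∷ʳ b)
suffix-∷ʳ⁺ {p} b (q , refl) = q , sym (++-assoc q p (b ∷ []))

suffix-∷ʳ⁻ : ∀ p {w c b} → Suffix (p ∷ʳ c) (w ∷ʳ b) → Suffix p w × c ≡ b
suffix-∷ʳ⁻ p {w} {c} (q , e) with ∷ʳ-injective (q ++ p) w (trans (++-assoc q p (c ∷ [])) e)
... | e′ , c≡b = (q , e′) , c≡b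

suffix-last : ∀ {w} b → Suffix (b ∷ []) (w ∷ʳ b)
suffix-last {w} b = w , refl

suffix-tail : ∀ {b p w} → Suffix (b ∷ p) w → Suffix p w
suffix-tail {b} (q , e) = q ∷ʳ b , trans (++-assoc q _ _) e

sub-∷ʳ⁻ : ∀ s {w b} → Sub s (w ∷ʳ b) → Sub s w ⊎ Suffix s (w ∷ʳ b)
sub-∷ʳ⁻ s {w} (p , q , e) with initLast q
... | [] = inj₂ (p , trans (cong (p ++_) (sym (++-identityʳ s))) e)
... | q′ ∷ʳ′ c = inj₁ (p , q′ , ∷ʳ-injectiveˡ (p ++ (s ++ q′)) w
        (trans (trans (++-assoc p (s ++ q′) (c ∷ [])) (cong (p ++_) (++-assoc s q′ (c ∷ [])))) e))

Dead : List Str → Str → Set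
Dead S w = Any (λ s → Sub s w) S

dead? : ∀ S w → Dec (Dead S w)
dead? S w = any? (λ s → sub? s w) S

dead⇒¬r : ∀ {S w} → Dead S w → ¬ r S w
dead⇒¬r (here s⊑w) (s⋢w ∷ _) = s⋢w s⊑w
dead⇒¬r (there d) (_ ∷ h) = dead⇒¬r d h

r? : ∀ S w → Dec (r S w)
r? S w = all? (λ s → ¬? (sub? s w)) S

r-sub : ∀ {S u w} → Sub u w → r S w → r S u
r-sub u⊑w = All.map (λ s⋢w s⊑u → s⋢w (sub-trans s⊑u u⊑w))

-- Stronger restrictions favour the Seeker: if every word of `S` contains a word of `T`, then `r T`
-- lies inside `r S`, and a win for `r S` is a win for `r T`.
Covers : List Str → List Str → Set
Covers T S = All (Dead T) S

covers? : ∀ T S → Dec (Covers T S)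
covers? T = all? (dead? T)

r-mono : ∀ {T S w} → Covers T S → r T w → r S w
r-mono {T} {w = w} cov h = All.map (λ d s⊑w → dead⇒¬r {T} (Any.map (λ t⊑s → sub-trans t⊑s s⊑w) d) h) cov

-- Reduction to two candidates

-- Complementing a question exchanges its answers, so for two candidates only two kinds of question
-- remain: non-separating and separating.
data Wins₂ (R : Str → Set) (u v : Str) : Set where
  dead : ¬ R u ⊎ ¬ R v → Wins₂ R u v
  same : Wins₂ R (u ∷ʳ b0) (v ∷ʳ b0) → Wins₂ R (u ∷ʳ b1) (v ∷ʳ b1) → Wins₂ R u v
  diff : Wins₂ R (u ∷ʳ b0) (v ∷ʳ b1) → Wins₂ R (u ∷ʳ b1) (v ∷ʳ b0) → Wins₂ R u v

wins₂-mono : ∀ {R R′ u v} → (∀ {w} → R′ w → R w) → Wins₂ R u v → Wins₂ R′ u v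
wins₂-mono f (dead (inj₁ d)) = dead (inj₁ (d ∘ f))
wins₂-mono f (dead (inj₂ d)) = dead (inj₂ (d ∘ f))
wins₂-mono f (same p q) = same (wins₂-mono f p) (wins₂-mono f q)
wins₂-mono f (diff p q) = diff (wins₂-mono f p) (wins₂-mono f q)

wins₂-sym : ∀ {R u v} → Wins₂ R u v → Wins₂ R v u
wins₂-sym (dead (inj₁ d)) = dead (inj₂ d)
wins₂-sym (dead (inj₂ d)) = dead (inj₁ d)
wins₂-sym (same p q) = same (wins₂-sym p) (wins₂-sym q)
wins₂-sym (diff p q) = diff (wins₂-sym q) (wins₂-sym p)

-- `AtMostOne` only excludes that both candidates survive; deciding `R` tells which of them is
-- eliminated.
wins⇒wins₂ : ∀ {R} → (∀ w → Dec (R w)) → {st : Fin 2 → Str} →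
  Wins R st → Wins₂ R (st zero) (st (suc zero))
wins⇒wins₂ R? {st} (done unique) with R? (st zero) | R? (st (suc zero))
... | no ¬Ru | _ = dead (inj₁ ¬Ru)
... | yes _ | no ¬Rv = dead (inj₂ ¬Rv)
... | yes Ru | yes Rv = contradiction (unique zero (suc zero) Ru Rv) λ ()
wins⇒wins₂ R? (ask Q f)
  with Q zero | Q (suc zero) | wins⇒wins₂ R? (f b0) | wins⇒wins₂ R? (f b1)
... | b0 | b0 | w₀ | w₁ = same w₀ w₁
... | b1 | b1 | w₀ | w₁ = same w₁ w₀
... | b0 | b1 | w₀ | w₁ = diff w₀ w₁
... | b1 | b0 | w₀ | w₁ = diff w₁ w₀

pick : Bit → Str → Str → Str
pick b0 u v = u
pick b1 u v = v

module _ {S : List Str} {n : ℕ} where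

  -- `base` holds the patterns at the start of a round. All candidates of one side receive the same
  -- bits, and `finish` takes over as soon as a side is eliminated.
  play : (side : Fin n → Bit) (base : Fin n → Str) →
    (∀ st → (∀ y → r S (st y) → r S (base y)) →
      (∀ y → side y ≡ b0 → ¬ r S (st y)) ⊎ (∀ y → side y ≡ b1 → ¬ r S (st y)) → Wins (r S) st) →
    ∀ {u v} → Wins₂ (r S) u v →
    ∀ st → (∀ y → st y ≡ base y ++ pick (side y) u v) → Wins (r S) st
  play side base finish {u} {v} (dead d) st eq =
      finish st (λ y → r-sub ([] , _ , sym (eq y))) (Sum.map side-dead side-dead d)
    where
    side-dead : ∀ {b} → ¬ r S (pick b u v) → ∀ y → side y ≡ b → ¬ r S (st y)
    side-dead ¬w y refl = ¬w ∘ r-sub (suffix⇒sub (base y , sym (eq y)))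
  play side base finish {u} {v} (same w₀ w₁) st eq = ask (λ _ → b0) λ where
      b0 → play side base finish w₀ _ (extend b0)
      b1 → play side base finish w₁ _ (extend b1)
    where
    extend : ∀ a y → st y ∷ʳ lieBit a b0 ≡ base y ++ pick (side y) (u ∷ʳ lieBit a b0) (v ∷ʳ lieBit a b0)
    extend a y rewrite eq y with side y
    ... | b0 = ++-assoc (base y) u _
    ... | b1 = ++-assoc (base y) v _
  play side base finish {u} {v} (diff w₀ w₁) st eq = ask side λ where
      b0 → play side base finish w₀ _ (extend b0)
      b1 → play side base finish w₁ _ (extend b1)
    where
    extend : ∀ a y → st y ∷ʳ lieBit a (side y) ≡
      base y ++ pick (side y) (u ∷ʳ lieBit a b0) (v ∷ʳ lieBit a b1)
    extend a y rewrite eq y with side y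
    ... | b0 = ++-assoc (base y) u _
    ... | b1 = ++-assoc (base y) v _

  module _ (w : Wins₂ (r S) [] []) where

    -- `xs` is an upper bound for the live candidates. A round sets its head against all others:
    -- either the head is eliminated and `xs` shrinks, or only the head can be left.
    wins-from : (xs : List (Fin n)) (st : Fin n → Str) → (∀ y → r S (st y) → y ∈ xs) → Wins (r S) st
    wins-from [] st alive = done λ y z hy hz → contradiction (alive y hy) λ ()
    wins-from (x ∷ []) st alive = done λ y z hy hz → trans (only (alive y hy)) (sym (only (alive z hz)))
      where
      only : ∀ {y} → y ∈ x ∷ [] → y ≡ x
      only (here e) = e
    wins-from (x ∷ x′ ∷ xs) st alive =
        play side st (finish (wins-from (x′ ∷ xs))) w st
          λ y → sym (trans (cong (st y ++_) (nil (side y))) (++-identityʳ (st y)))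
      where
      side : Fin n → Bit
      side y = if does (y Fin.≟ x) then b0 else b1
      nil : ∀ b → pick b [] [] ≡ []
      nil b0 = refl
      nil b1 = refl
      side-x : side x ≡ b0
      side-x with x Fin.≟ x
      ... | yes _ = refl
      ... | no x≢x = contradiction refl x≢x
      side-other : ∀ {y} → y ≢ x → side y ≡ b1
      side-other {y} y≢x with y Fin.≟ x
      ... | yes y≡x = contradiction y≡x y≢x
      ... | no _ = refl
      finish : (∀ st′ → (∀ y → r S (st′ y) → y ∈ x′ ∷ xs) → Wins (r S) st′) →
        ∀ st′ → (∀ y → r S (st′ y) → r S (st y)) →
        (∀ y → side y ≡ b0 → ¬ r S (st′ y)) ⊎ (∀ y → side y ≡ b1 → ¬ r S (st′ y)) → Wins (r S) st′
      finish continue st′ shrink (inj₁ x-dead) = continue st′ λ y hy → rest hy (alive y (shrink y hy))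
        where
        rest : ∀ {y} → r S (st′ y) → y ∈ x ∷ x′ ∷ xs → y ∈ x′ ∷ xs
        rest hy (here refl) = contradiction hy (x-dead x side-x)
        rest hy (there y∈) = y∈
      finish _ st′ shrink (inj₂ others-dead) = done λ y z hy hz → trans (is-x y hy) (sym (is-x z hz))
        where
        is-x : ∀ y → r S (st′ y) → y ≡ x
        is-x y hy with y Fin.≟ x
        ... | yes y≡x = y≡x
        ... | no y≢x = contradiction hy (others-dead y (side-other y≢x))

wins₂⇒seeker : ∀ {S} → Wins₂ (r S) [] [] → SeekerWins (r S)
wins₂⇒seeker w n _ = wins-from w (allFin n) _ λ y _ → ∈-allFin y

seeker⇒wins₂ : ∀ {S} → SeekerWins (r S) → Wins₂ (r S) [] []
seeker⇒wins₂ {S} h = wins⇒wins₂ (r? S) (h 2 (s≤s z≤n))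

-- Exchanging 0 and 1

flip : Str → Str
flip = map flipBit

flip-involutive : ∀ w → flip (flip w) ≡ w
flip-involutive [] = refl
flip-involutive (b0 ∷ w) = cong (b0 ∷_) (flip-involutive w)
flip-involutive (b1 ∷ w) = cong (b1 ∷_) (flip-involutive w)

sub-flip⁺ : ∀ {s w} → Sub s w → Sub (flip s) (flip w)
sub-flip⁺ {s} (p , q , refl) = flip p , flip q ,
  sym (trans (map-++ flipBit p _) (cong (flip p ++_) (map-++ flipBit s q)))

r-flip⁻ : ∀ S {w} → r (map flip S) (flip w) → r S w
r-flip⁻ [] [] = []
r-flip⁻ (s ∷ S) (h ∷ hs) = h ∘ sub-flip⁺ ∷ r-flip⁻ S hs

-- Flipping the bits of both patterns amounts to exchanging the answers, so the two branches trade
-- places.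
wins₂-flip : ∀ {S u v} → Wins₂ (r S) u v → Wins₂ (r (map flip S)) (flip u) (flip v)
wins₂-flip {S} (dead (inj₁ d)) = dead (inj₁ (d ∘ r-flip⁻ S))
wins₂-flip {S} (dead (inj₂ d)) = dead (inj₂ (d ∘ r-flip⁻ S))
wins₂-flip {S} {u} {v} (same p q) = same
  (subst₂ (Wins₂ _) (map-++ flipBit u _) (map-++ flipBit v _) (wins₂-flip q))
  (subst₂ (Wins₂ _) (map-++ flipBit u _) (map-++ flipBit v _) (wins₂-flip p))
wins₂-flip {S} {u} {v} (diff p q) = diff
  (subst₂ (Wins₂ _) (map-++ flipBit u _) (map-++ flipBit v _) (wins₂-flip q))
  (subst₂ (Wins₂ _) (map-++ flipBit u _) (map-++ flipBit v _) (wins₂-flip p))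

-- Seeker: bounded search

-- The words are kept reversed, so that only a prefix has to be inspected after each answer.
module Search (S : List Str) where

  Lost : Str → Set
  Lost x = Any (λ s → Prefix s x) (map reverse S)

  lost? : ∀ x → Dec (Lost x)
  lost? x = any? (λ s → prefix? s x) (map reverse S)

  data WinsWithin : ℕ → Str → Str → Set where
    lost : ∀ {n x y} → Lost x ⊎ Lost y → WinsWithin n x y
    diff : ∀ {n x y} → WinsWithin n (b0 ∷ x) (b1 ∷ y) → WinsWithin n (b1 ∷ x) (b0 ∷ y) →
      WinsWithin (suc n) x y
    same : ∀ {n x y} → WinsWithin n (b0 ∷ x) (b0 ∷ y) → WinsWithin n (b1 ∷ x) (b1 ∷ y) →
      WinsWithin (suc n) x y

  winsWithin? : ∀ n x y → Dec (WinsWithin n x y)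
  winsWithin? zero x y = map′ lost (λ { (lost l) → l }) (lost? x ⊎-dec lost? y)
  winsWithin? (suc n) x y =
    map′ [ lost , [ (λ (h , h′) → diff h h′) , (λ (h , h′) → same h h′) ]′ ]′
      (λ { (lost l) → inj₁ l ; (diff h h′) → inj₂ (inj₁ (h , h′)) ; (same h h′) → inj₂ (inj₂ (h , h′)) })
      ((lost? x ⊎-dec lost? y)
        ⊎-dec (winsWithin? n (b0 ∷ x) (b1 ∷ y) ×-dec winsWithin? n (b1 ∷ x) (b0 ∷ y))
        ⊎-dec (winsWithin? n (b0 ∷ x) (b0 ∷ y) ×-dec winsWithin? n (b1 ∷ x) (b1 ∷ y)))

  lost⇒dead : ∀ {x} → Lost x → Dead S (reverse x)
  lost⇒dead {x} = Any.map (λ {s} → suffix⇒sub ∘ reversed s) ∘ Any.map⁻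
    where
    reversed : ∀ s {x} → Prefix (reverse s) x → Suffix s (reverse x)
    reversed s (q , refl) = reverse q ,
      sym (trans (reverse-++ (reverse s) q) (cong (reverse q ++_) (reverse-involutive s)))

  lost⇒wins₂ : ∀ {x y} → Lost x ⊎ Lost y → Wins₂ (r S) (reverse x) (reverse y)
  lost⇒wins₂ {x} (inj₁ l) = dead (inj₁ (dead⇒¬r (lost⇒dead {x} l)))
  lost⇒wins₂ {y = y} (inj₂ l) = dead (inj₂ (dead⇒¬r (lost⇒dead {y} l)))

  winsWithin⇒wins₂ : ∀ {n x y} → WinsWithin n x y → Wins₂ (r S) (reverse x) (reverse y)
  winsWithin⇒wins₂ {x = x} {y} (lost l) = lost⇒wins₂ {x} {y} l
  winsWithin⇒wins₂ {x = x} {y} (diff h h′) = diff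
    (subst₂ (Wins₂ _) (unfold-reverse b0 x) (unfold-reverse b1 y) (winsWithin⇒wins₂ h))
    (subst₂ (Wins₂ _) (unfold-reverse b1 x) (unfold-reverse b0 y) (winsWithin⇒wins₂ h′))
  winsWithin⇒wins₂ {x = x} {y} (same h h′) = same
    (subst₂ (Wins₂ _) (unfold-reverse b0 x) (unfold-reverse b0 y) (winsWithin⇒wins₂ h))
    (subst₂ (Wins₂ _) (unfold-reverse b1 x) (unfold-reverse b1 y) (winsWithin⇒wins₂ h′))

-- Seeker: the exceptional pairs and the short words

pairOf : Str × Str → List Str
pairOf (s , t) = s ∷ t ∷ []

Wins10 : List Str → Set
Wins10 S = Search.WinsWithin S 10 [] []

wins10? : ∀ S → Dec (Wins10 S)
wins10? S = Search.winsWithin? S 10 [] []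

wins10⇒wins₂ : ∀ {S} → Wins10 S → Wins₂ (r S) [] []
wins10⇒wins₂ {S} = Search.winsWithin⇒wins₂ S

abstract
  exceptional-search : All (Wins10 ∘ pairOf) exceptional
  exceptional-search = from-yes (all? (wins10? ∘ pairOf) exceptional)

exceptional-wins : ∀ {p} → p ∈ exceptional → Wins₂ (r (pairOf p)) [] []
exceptional-wins p∈ = wins10⇒wins₂ (All.lookup exceptional-search p∈)

-- Each short word is a factor of 01 or of 10, so by monotonicity two searches settle all four.
short-wins : ∀ {s t} → CondA s t → Wins₂ (r (s ∷ t ∷ [])) [] []
short-wins {s} {t} = [ (λ s∈ → wins s∈ (here sub-refl)) , (λ t∈ → wins t∈ (there (here sub-refl))) ]′
  where
  via : ∀ {w S} → Wins₂ (r (w ∷ w ∷ [])) [] [] → Dead S w → Wins₂ (r S) [] []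
  via win d = wins₂-mono (r-mono (d ∷ d ∷ [])) win
  01s 10s : List Str
  01s = (b0 ∷ b1 ∷ []) ∷ (b0 ∷ b1 ∷ []) ∷ []
  10s = (b1 ∷ b0 ∷ []) ∷ (b1 ∷ b0 ∷ []) ∷ []
  wins-01s : Wins₂ (r 01s) [] []
  wins-01s = wins10⇒wins₂ (from-yes (wins10? 01s))
  wins-10s : Wins₂ (r 10s) [] []
  wins-10s = wins10⇒wins₂ (from-yes (wins10? 10s))
  inside : ∀ {S x w} → Sub x w → Dead S x → Dead S w
  inside x⊑w = Any.map (λ s⊑x → sub-trans s⊑x x⊑w)
  wins : ∀ {S x} → x ∈ shortList → Dead S x → Wins₂ (r S) [] []
  wins (here refl) d = via wins-01s (inside ([] , b1 ∷ [] , refl) d)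
  wins (there (here refl)) d = via wins-01s (inside (b0 ∷ [] , [] , refl) d)
  wins (there (there (here refl))) d = via wins-01s d
  wins (there (there (there (here refl)))) d = via wins-10s d

-- Seeker: words of R#

ones : ℕ → Str
ones n = replicate n b1

alternate : ℕ → Str
alternate zero = []
alternate (suc j) = b1 ∷ b0 ∷ alternate j

-- The paper's 1ᵃ(01)ʲ01ᶜ, bracketed as 1ᵃ0(10)ʲ1ᶜ.
normal : ℕ → ℕ → ℕ → Str
normal a j c = ones a ++ b0 ∷ alternate j ++ ones c

gapWord : ℕ → Str
gapWord k = b0 ∷ (ones k ++ b0 ∷ [])

data Shape (w : Str) : Set where
  all-ones : ∀ a → w ≡ ones a → Shape w
  zigzag : ∀ a j c → w ≡ normal a j c → Shape w
  gap : ∀ k → k ≡ 0 ⊎ 2 ≤ k → Sub (gapWord k) w → Shape w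

gap-prefix : ∀ k u → Sub (gapWord k) (b0 ∷ ones k ++ b0 ∷ u)
gap-prefix k u = [] , u , cong (b0 ∷_) (++-assoc (ones k) (b0 ∷ []) u)

-- Letters are added on the left. A 0 put before 1ᵃ0 creates 00 if a = 0, lengthens the alternation
-- if a = 1, and creates the gap word 01ᵃ0 if a ≥ 2.
shape : ∀ w → Shape w
shape [] = all-ones 0 refl
shape (b ∷ w) with shape w
shape (b ∷ w) | gap k k≢1 (p , q , e) = gap k k≢1 (b ∷ p , q , cong (b ∷_) e)
shape (b1 ∷ w) | all-ones a refl = all-ones (suc a) refl
shape (b1 ∷ w) | zigzag a j c refl = zigzag (suc a) j c refl
shape (b0 ∷ w) | all-ones a refl = zigzag 0 0 a refl
shape (b0 ∷ w) | zigzag 0 j c refl = gap 0 (inj₁ refl) (gap-prefix 0 _)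
shape (b0 ∷ w) | zigzag 1 j c refl = zigzag 0 (suc j) c refl
shape (b0 ∷ w) | zigzag (suc (suc a)) j c refl =
  gap (suc (suc a)) (inj₂ (s≤s (s≤s z≤n))) (gap-prefix (suc (suc a)) _)

module _ {S : List Str} where

  kill : ∀ {s u v} → s ∈ S → Suffix s u → Wins₂ (r S) u v
  kill s∈ h = dead (inj₁ (dead⇒¬r (Any.map (λ { refl → suffix⇒sub h }) s∈)))

  -- N describes the words reachable while both candidates are under the Seeker's control; each
  -- rule leaves the Obscurer with harmful alternatives to the continuation it asks for.
  record Control (N : Str → Set) : Set where
    Goal : Str → Str → Set
    Goal u v = N u → N v → Wins₂ (r S) u v
    field
      both-one : ∀ {u v} → Goal (u ∷ʳ b1) (v ∷ʳ b1) → Goal u v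
      one-zero : ∀ {u v} → Goal (u ∷ʳ b0) (v ∷ʳ b1) → Goal (u ∷ʳ b1) (v ∷ʳ b0) → Goal u v
      after-zero : ∀ {u v} → Goal (u ∷ʳ b0 ∷ʳ b1) (v ∷ʳ b0) → Goal (u ∷ʳ b0) v

  module Drive {N : Str → Set} (control : Control N) {T : Str} (T∈ : T ∈ S) where
    open Control control

    swap : ∀ {u v} → Goal v u → Goal u v
    swap g nu nv = wins₂-sym (g nv nu)

    -- `x` is the part of `T` already spelled at the end of `u`.
    drive-ones : ∀ c x {u v} → Suffix x u → x ++ ones c ≡ T → Goal u v
    drive-ones zero x h refl _ _ = kill T∈ (subst (λ t → Suffix t _) (sym (++-identityʳ x)) h)
    drive-ones (suc c) x h e = both-one
      (drive-ones c (x ∷ʳ b1) (suffix-∷ʳ⁺ b1 h) (trans (++-assoc x _ _) e))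

    drive-alternate : ∀ j c x {u v} → Suffix x (u ∷ʳ b0) → x ++ alternate j ++ ones c ≡ T → Goal (u ∷ʳ b0) v
    drive-alternate zero c x h e = drive-ones c x h e
    -- Two questions append 10 to `u`: first `u` takes 1 and `v` takes 0, then, with the roles
    -- exchanged, `v` takes 1 and `u` takes 0.
    drive-alternate (suc j) c x h e = after-zero (swap (after-zero (swap
      (drive-alternate j c (x ∷ʳ b1 ∷ʳ b0) (suffix-∷ʳ⁺ b0 (suffix-∷ʳ⁺ b1 h))
        (trans (++-assoc (x ∷ʳ b1) _ _) (trans (++-assoc x _ _) e))))))

    -- Both candidates spell the leading ones together, so whichever of them receives the first 0
    -- can be made to complete `T`.
    drive : ∀ a j c x {u v} → Suffix x u → Suffix x v → x ++ normal a j c ≡ T → Goal u v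
    drive zero j c x hu hv e = one-zero (target hu) (swap (target hv))
      where
      target : ∀ {u v} → Suffix x u → Goal (u ∷ʳ b0) v
      target h = drive-alternate j c (x ∷ʳ b0) (suffix-∷ʳ⁺ b0 h) (trans (++-assoc x _ _) e)
    drive (suc a) j c x hu hv e = both-one
      (drive a j c (x ∷ʳ b1) (suffix-∷ʳ⁺ b1 hu) (suffix-∷ʳ⁺ b1 hv) (trans (++-assoc x _ _) e))

  module Avoiding001 {T : Str} (001∈ : (b0 ∷ b0 ∷ b1 ∷ []) ∈ S) (T∈ : T ∈ S) where

    -- A candidate ending in 00 can only receive 0, so the other one can be made to spell T.
    spell : ∀ t x {u v} → x ++ t ≡ T → Suffix (b0 ∷ b0 ∷ []) u → Suffix x v → Wins₂ (r S) u v
    spell [] x refl z h = wins₂-sym (kill T∈ (subst (λ t → Suffix t _) (sym (++-identityʳ x)) h))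
    spell (b ∷ t) x {u} {v} e z h = next b refl
      where
      continue : Wins₂ (r S) (u ∷ʳ b0) (v ∷ʳ b)
      continue = spell t (x ∷ʳ b) (trans (++-assoc x _ _) e)
        (suffix-tail (suffix-∷ʳ⁺ b0 z)) (suffix-∷ʳ⁺ b h)
      lost : ∀ {v} → Wins₂ (r S) (u ∷ʳ b1) v
      lost = kill 001∈ (suffix-∷ʳ⁺ b1 z)
      next : ∀ b′ → b ≡ b′ → Wins₂ (r S) u v
      next b0 refl = same continue lost
      next b1 refl = diff continue lost

    zeros : ∀ {u v} → Wins₂ (r S) (u ∷ʳ b0 ∷ʳ b0) v
    zeros = spell T [] refl (suffix-∷ʳ⁺ b0 (suffix-last b0)) suffix-[]

    control : Control (λ _ → ⊤)
    control = record
      -- After a common 0, a separating question gives one of the candidates 00.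
      { both-one = λ g _ _ → same (diff zeros (wins₂-sym zeros)) (g tt tt)
      ; one-zero = λ g h _ _ → diff (g tt tt) (h tt tt)
      ; after-zero = λ g _ _ → diff zeros (g tt tt)
      }

  module Avoiding100 (100∈ : (b1 ∷ b0 ∷ b0 ∷ []) ∈ S) where

    -- For a candidate ending in 1 or 10, the second 0 in a row completes 100.
    N : Str → Set
    N u = Suffix (b1 ∷ []) u ⊎ Suffix (b1 ∷ b0 ∷ []) u

    lost : ∀ {u v} → Suffix (b1 ∷ b0 ∷ []) u → Wins₂ (r S) (u ∷ʳ b0) v
    lost h = kill 100∈ (suffix-∷ʳ⁺ b0 h)

    zero-step : ∀ {u v} → (N (u ∷ʳ b0) → Wins₂ (r S) (u ∷ʳ b0) v) → N u → Wins₂ (r S) (u ∷ʳ b0) v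
    zero-step g (inj₁ h) = g (inj₂ (suffix-∷ʳ⁺ b0 h))
    zero-step g (inj₂ h) = lost h

    zero-stepʳ : ∀ {u v} → (N (v ∷ʳ b0) → Wins₂ (r S) u (v ∷ʳ b0)) → N v → Wins₂ (r S) u (v ∷ʳ b0)
    zero-stepʳ g = wins₂-sym ∘ zero-step (wins₂-sym ∘ g)

    one-step : ∀ {u} → N (u ∷ʳ b1)
    one-step = inj₁ (suffix-last b1)

    twice : ∀ {u v} → N (u ∷ʳ b0) → Wins₂ (r S) (u ∷ʳ b0 ∷ʳ b0) v
    twice (inj₁ h) = contradiction (proj₂ (suffix-∷ʳ⁻ [] h)) λ ()
    twice (inj₂ h) = lost h

    control : Control N
    control = record
      { both-one = λ g nu nv → same
          (zero-step (λ nu′ → zero-stepʳ (λ nv′ → diff (twice nu′) (wins₂-sym (twice nv′))) nv) nu)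
          (g one-step one-step)
      ; one-zero = λ g h nu nv → diff
          (zero-step (λ nu′ → g nu′ one-step) nu)
          (zero-stepʳ (λ nv′ → h one-step nv′) nv)
      ; after-zero = λ g nu nv → diff (twice nu) (zero-stepʳ (λ nv′ → g one-step nv′) nv)
      }

    -- Brings both candidates into `N`: a separating question makes one of them end in 1, and since
    -- that one cannot take 00, at most two non-separating questions give both a common 1.
    start : (∀ {u v} → N u → N v → Wins₂ (r S) u v) → ∀ {u v} → Wins₂ (r S) u v
    start g = diff (wins₂-sym (from-one (suffix-last b1))) (from-one (suffix-last b1))
      where
      from-one : ∀ {u v} → Suffix (b1 ∷ []) u → Wins₂ (r S) u v
      from-one h = same (same (lost (suffix-∷ʳ⁺ b0 h)) (g one-step one-step)) (g one-step one-step)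

-- Seeker: case (c)

zeroList-wins : ∀ {s t} → s ∈ zeroList → R# t → Wins₂ (r (s ∷ t ∷ [])) [] []
zeroList-wins {s} {t} s∈ t∈R# = wins s∈ (shape t)
  where
  wins001 : ∀ a j c → Wins₂ (r ((b0 ∷ b0 ∷ b1 ∷ []) ∷ normal a j c ∷ [])) [] []
  wins001 a j c = Drive.drive (Avoiding001.control (here refl) (there (here refl)))
    (there (here refl)) a j c [] suffix-[] suffix-[] refl tt tt
  wins100 : ∀ a j c → Wins₂ (r ((b1 ∷ b0 ∷ b0 ∷ []) ∷ normal a j c ∷ [])) [] []
  wins100 a j c = Avoiding100.start (here refl) (Drive.drive (Avoiding100.control (here refl))
    (there (here refl)) a j c [] suffix-[] suffix-[] refl)
  wins-normal : ∀ {s t} a j c → s ∈ zeroList → Sub t (normal a j c) → Wins₂ (r (s ∷ t ∷ [])) [] []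
  -- The win for 001 is inherited by its factor 00.
  wins-normal a j c (here refl) t⊑ =
    wins₂-mono (r-mono (here ([] , b1 ∷ [] , refl) ∷ there (here t⊑) ∷ [])) (wins001 a j c)
  wins-normal a j c (there (here refl)) t⊑ =
    wins₂-mono (r-mono (here sub-refl ∷ there (here t⊑) ∷ [])) (wins001 a j c)
  wins-normal a j c (there (there (here refl))) t⊑ =
    wins₂-mono (r-mono (here sub-refl ∷ there (here t⊑) ∷ [])) (wins100 a j c)
  wins : ∀ {s} → s ∈ zeroList → Shape t → Wins₂ (r (s ∷ t ∷ [])) [] []
  -- The word 1ᵃ is handled as a factor of 1ᵃ0.
  wins s∈ (all-ones a refl) = wins-normal a 0 0 s∈ ([] , b0 ∷ [] , refl)
  wins s∈ (zigzag a j c refl) = wins-normal a j c s∈ sub-refl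
  wins s∈ (gap k k≢1 g) = contradiction g (t∈R# k k≢1)

flip-oneList : ∀ {s} → s ∈ oneList → flip s ∈ zeroList
flip-oneList (here refl) = here refl
flip-oneList (there (here refl)) = there (here refl)
flip-oneList (there (there (here refl))) = there (there (here refl))

wins₂-flip⁻ : ∀ {s t} → Wins₂ (r (flip s ∷ flip t ∷ [])) [] [] → Wins₂ (r (s ∷ t ∷ [])) [] []
wins₂-flip⁻ {s} {t} w =
  subst₂ (λ s t → Wins₂ (r (s ∷ t ∷ [])) [] []) (flip-involutive s) (flip-involutive t) (wins₂-flip w)

wins₂-swap : ∀ {s t} → Wins₂ (r (s ∷ t ∷ [])) [] [] → Wins₂ (r (t ∷ s ∷ [])) [] []
wins₂-swap = wins₂-mono (r-mono (there (here sub-refl) ∷ here sub-refl ∷ []))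

CondC-wins : ∀ {s t} → CondCOrdered s t → Wins₂ (r (s ∷ t ∷ [])) [] []
CondC-wins (inj₁ (s∈ , t∈R#)) = zeroList-wins s∈ t∈R#
CondC-wins (inj₂ (s∈ , t∈R#inv)) = wins₂-flip⁻ (zeroList-wins (flip-oneList s∈) t∈R#inv)

-- Obscurer: closed sets of positions

module Evasion {R : Str → Set} {Q : Set} (δ : Q → Bit → Q) (Safe : Q → Bit → Set)
  (Tracks : Str → Q → Set)
  (sound : ∀ {w q} → Tracks w q → R w)
  (follow : ∀ {w q} b → Tracks w q → Safe q b → Tracks (w ∷ʳ b) (δ q b))
  (P : Q → Q → Set) where

  Move : Q → Q → Bit → Bit → Set
  Move p q a b = Safe p a × Safe q b × P (δ p a) (δ q b)

  -- One admissible reply to a non-separating question and one to a separating question.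
  Answer : Q → Q → Set
  Answer p q = (Move p q b0 b0 ⊎ Move p q b1 b1) × (Move p q b0 b1 ⊎ Move p q b1 b0)

  module _ (answer : ∀ {p q} → P p q → Answer p q) where

    -- A strategy is a well-founded tree. Following the Obscurer's replies down the tree keeps both
    -- patterns in `R`, so it can never end in `dead`.
    evade : ∀ {u v p q} → P p q → Tracks u p → Tracks v q → ¬ Wins₂ R u v
    evade _ tu tv (dead (inj₁ ¬u)) = ¬u (sound tu)
    evade _ tu tv (dead (inj₂ ¬v)) = ¬v (sound tv)
    evade pq tu tv (same w₀ w₁) with proj₁ (answer pq)
    ... | inj₁ (sp , sq , pq′) = evade pq′ (follow b0 tu sp) (follow b0 tv sq) w₀
    ... | inj₂ (sp , sq , pq′) = evade pq′ (follow b1 tu sp) (follow b1 tv sq) w₁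
    evade pq tu tv (diff w₀ w₁) with proj₂ (answer pq)
    ... | inj₁ (sp , sq , pq′) = evade pq′ (follow b0 tu sp) (follow b1 tv sq) w₀
    ... | inj₂ (sp , sq , pq′) = evade pq′ (follow b1 tu sp) (follow b0 tv sq) w₁

-- Obscurer: Aho-Corasick states and the minimal pairs

module AhoCorasick (S : List Str) where

  Live : Str → Set
  Live u = All (λ s → ¬ Suffix s u) S

  live? : ∀ u → Dec (Live u)
  live? u = all? (λ s → ¬? (suffix? s u)) S

  Begins : Str → Set
  Begins p = Any (Prefix p) S

  begins? : ∀ p → Dec (Begins p)
  begins? p = any? (prefix? p) S

  -- The failure function of the automaton: dropping letters from the left leaves the longest suffix
  -- that begins a forbidden word.
  trim : Str → Str
  trim [] = []
  trim (x ∷ w) = if does (begins? (x ∷ w)) then x ∷ w else trim w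

  trim-suffix : ∀ {p} w → Begins p → Suffix p w → Suffix p (trim w)
  trim-suffix [] _ h = h
  trim-suffix (x ∷ w) bp h with begins? (x ∷ w)
  trim-suffix (x ∷ w) bp h | yes _ = h
  trim-suffix (x ∷ w) bp ([] , refl) | no ¬b = contradiction bp ¬b
  trim-suffix (x ∷ w) bp (_ ∷ q , refl) | no _ = trim-suffix w bp (q , refl)

  -- The state retains every suffix of the pattern that may still grow into a forbidden word.
  Tracks : Str → Str → Set
  Tracks w u = r S w × (∀ p → Begins p → Suffix p w → Suffix p u)

  δ : Str → Bit → Str
  δ u b = trim (u ∷ʳ b)

  Safe : Str → Bit → Set
  Safe u b = Live (δ u b)

  -- A new forbidden occurrence ends at the new bit. Without its last bit, a suffix that begins a
  -- forbidden word is again such a suffix, of `w`, hence retained in `u`.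
  follow : ∀ {w u} b → Tracks w u → Safe u b → Tracks (w ∷ʳ b) (δ u b)
  follow {w} {u} b (w∈r , tracked) live = All.tabulate avoids , tracked′
    where
    tracked′ : ∀ p → Begins p → Suffix p (w ∷ʳ b) → Suffix p (δ u b)
    tracked′ p bp h = trim-suffix (u ∷ʳ b) bp (extend (initLast p) bp h)
      where
      extend : ∀ {p} → InitLast p → Begins p → Suffix p (w ∷ʳ b) → Suffix p (u ∷ʳ b)
      extend [] _ _ = suffix-[]
      extend (p ∷ʳ′ c) bp h with suffix-∷ʳ⁻ p h
      ... | h′ , refl = suffix-∷ʳ⁺ b
        (tracked p (Any.map (λ (q , e) → b ∷ q , trans (sym (++-assoc p _ q)) e) bp) h′)
    avoids : ∀ {s} → s ∈ S → ¬ Sub s (w ∷ʳ b)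
    avoids {s} s∈ s⊑ with sub-∷ʳ⁻ s s⊑
    ... | inj₁ s⊑w = All.lookup w∈r s∈ s⊑w
    ... | inj₂ h = All.lookup live s∈ (tracked′ s (Any.map (λ { refl → [] , ++-identityʳ s }) s∈) h)

  tracks-[] : Live [] → Tracks [] []
  tracks-[] live = All.map (λ { {s} ¬h (p , q , e) → ¬h ([] , ++-conicalˡ s q (++-conicalʳ p _ e)) }) live ,
    λ _ _ h → h

  Positions : Set
  Positions = List (Str × Str)

  open DecMembership (×-≡-dec _≟ˢ_ _≟ˢ_) using (_∈?_)

  open module E (L : Positions) =
    Evasion {r S} δ Safe Tracks proj₁ follow (λ u v → (u , v) ∈ L) using (Answer; evade)

  answer? : ∀ L u v → Dec (Answer L u v)
  answer? L u v = (move? b0 b0 ⊎-dec move? b1 b1) ×-dec (move? b0 b1 ⊎-dec move? b1 b0)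
    where
    move? = λ a b → live? (δ u a) ×-dec live? (δ v b) ×-dec ((δ u a , δ v b) ∈? L)

  -- Iteration towards the greatest closed set of positions. `Evades` checks the outcome for
  -- closure, so the pruning itself needs no correctness proof.
  prune : ℕ → Positions → Positions
  prune zero L = L
  prune (suc n) L = prune n (filter (λ (u , v) → answer? L u v) L)

  region : ℕ → Positions
  region n = prune n (cartesianProduct states states)
    where
    states = filter live? (deduplicate _≟ˢ_ (concatMap inits S))

  Evades : Positions → Set
  Evades L = Live [] × ([] , []) ∈ L × All (λ (u , v) → Answer L u v) L

  evades? : ∀ L → Dec (Evades L)
  evades? L = live? [] ×-dec (([] , []) ∈? L) ×-dec all? (λ (u , v) → answer? L u v) L

  evades : ∀ L → Evades L → ¬ Wins₂ (r S) [] []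
  evades L (live , start , closed) = evade L (All.lookup closed) start (tracks-[] live) (tracks-[] live)

-- Beside 00 the words 01ᵏ0 stop at k = 4, where they have six letters, the depth of the
-- classification below; `Gaps` deals with arbitrary k ≥ 2. The pairs with 11 mirror them.
minimalPairs : List (Str × Str)
minimalPairs =
  ((O ∷ O ∷ []) , (O ∷ I ∷ I ∷ O ∷ [])) ∷
  ((O ∷ O ∷ []) , (O ∷ I ∷ I ∷ I ∷ O ∷ [])) ∷
  ((O ∷ O ∷ []) , (O ∷ I ∷ I ∷ I ∷ I ∷ O ∷ [])) ∷
  ((I ∷ I ∷ []) , (I ∷ O ∷ O ∷ I ∷ [])) ∷
  ((I ∷ I ∷ []) , (I ∷ O ∷ O ∷ O ∷ I ∷ [])) ∷
  ((I ∷ I ∷ []) , (I ∷ O ∷ O ∷ O ∷ O ∷ I ∷ [])) ∷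
  ((O ∷ O ∷ O ∷ []) , (O ∷ I ∷ O ∷ [])) ∷
  ((O ∷ O ∷ O ∷ []) , (I ∷ I ∷ I ∷ [])) ∷
  ((O ∷ I ∷ O ∷ []) , (I ∷ O ∷ I ∷ [])) ∷
  ((I ∷ O ∷ I ∷ []) , (I ∷ I ∷ I ∷ [])) ∷
  ((O ∷ I ∷ O ∷ []) , (O ∷ I ∷ I ∷ O ∷ [])) ∷
  ((O ∷ I ∷ O ∷ []) , (I ∷ O ∷ O ∷ I ∷ [])) ∷
  ((O ∷ I ∷ O ∷ []) , (I ∷ I ∷ I ∷ I ∷ [])) ∷
  ((I ∷ O ∷ I ∷ []) , (O ∷ O ∷ O ∷ O ∷ [])) ∷
  ((I ∷ O ∷ I ∷ []) , (O ∷ I ∷ I ∷ O ∷ [])) ∷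
  ((I ∷ O ∷ I ∷ []) , (I ∷ O ∷ O ∷ I ∷ [])) ∷
  ((O ∷ O ∷ O ∷ []) , (I ∷ I ∷ O ∷ I ∷ I ∷ [])) ∷
  ((O ∷ I ∷ O ∷ []) , (O ∷ I ∷ I ∷ I ∷ O ∷ [])) ∷
  ((I ∷ O ∷ I ∷ []) , (I ∷ O ∷ O ∷ O ∷ I ∷ [])) ∷
  ((I ∷ I ∷ I ∷ []) , (O ∷ O ∷ I ∷ O ∷ O ∷ [])) ∷
  ((O ∷ O ∷ I ∷ I ∷ []) , (I ∷ O ∷ I ∷ O ∷ [])) ∷
  ((O ∷ I ∷ O ∷ I ∷ []) , (I ∷ I ∷ O ∷ O ∷ [])) ∷
  []
  where
  O I : Bit
  O = b0
  I = b1

-- Seven rounds of pruning are enough for each of these pairs.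
positions : Str × Str → List (Str × Str)
positions p = AhoCorasick.region (pairOf p) 7

EvadesPair : Str × Str → Set
EvadesPair p = AhoCorasick.Evades (pairOf p) (positions p)

abstract
  minimalPairs-closed : All EvadesPair minimalPairs
  minimalPairs-closed =
    from-yes (all? (λ p → AhoCorasick.evades? (pairOf p) (positions p)) minimalPairs)

minimalPairs-evade : ∀ {p} → p ∈ minimalPairs → ¬ Wins₂ (r (pairOf p)) [] []
minimalPairs-evade {p} p∈ =
  AhoCorasick.evades (pairOf p) (positions p) (All.lookup minimalPairs-closed p∈)

-- Obscurer: 00 and 01ᵏ0

module Gaps (k : ℕ) (2≤k : 2 ≤ k) where

  S : List Str
  S = (b0 ∷ b0 ∷ []) ∷ gapWord k ∷ []

  δ : ℕ → Bit → ℕ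
  δ j b0 = 0
  δ j b1 = suc j

  -- The number of 1s since the last 0; before the first 0 the count starts beyond k.
  distance : Str → ℕ
  distance = foldl δ (suc k)

  foldl-ones : ∀ i j → foldl δ i (ones j) ≡ i + j
  foldl-ones i zero = sym (ℕ.+-identityʳ i)
  foldl-ones i (suc j) = trans (foldl-ones (suc i) j) (sym (ℕ.+-suc i j))

  distance-suffix : ∀ j {w} → Suffix (b0 ∷ ones j) w → distance w ≡ j
  distance-suffix j (q , refl) = trans (foldl-++ δ (suc k) q _) (foldl-ones 0 j)

  -- A 0 at distance 0 completes 00, and at distance k it completes 01ᵏ0.
  Safe : ℕ → Bit → Set
  Safe j b0 = j ≢ 0 × j ≢ k
  Safe j b1 = ⊤

  Tracks : Str → ℕ → Set
  Tracks w j = r S w × distance w ≡ j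

  follow : ∀ {w j} b → Tracks w j → Safe j b → Tracks (w ∷ʳ b) (δ j b)
  follow {w} b ((¬00 ∷ ¬gap ∷ []) , refl) safe =
    [ ¬00 , closes 0 b safe proj₁ ]′ ∘ sub-∷ʳ⁻ _ ∷
    [ ¬gap , closes k b safe proj₂ ]′ ∘ sub-∷ʳ⁻ _ ∷ [] ,
    foldl-∷ʳ δ (suc k) b w
    where
    closes : ∀ i b → Safe (distance w) b →
      (distance w ≢ 0 × distance w ≢ k → distance w ≢ i) → ¬ Suffix (gapWord i) (w ∷ʳ b)
    closes i b safe pr h with suffix-∷ʳ⁻ (b0 ∷ ones i) h
    ... | h′ , refl = pr safe (distance-suffix i h′)

  -- A separating question needs a candidate that can take 0, so the distances must not both lie in
  -- {0, k}. Equal distances would reach k together under common ones, unless they are already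
  -- beyond k.
  record Apart (i j : ℕ) : Set where
    constructor apart
    field
      distinct : i ≡ j → k < i
      ¬0k : ¬ (i ≡ 0 × j ≡ k)
      ¬k0 : ¬ (i ≡ k × j ≡ 0)
  open Apart

  apart-sym : ∀ {i j} → Apart i j → Apart j i
  apart-sym (apart d z z′) = apart (λ { refl → d refl }) (λ (x , y) → z′ (y , x)) (λ (x , y) → z (y , x))

  apart-0 : ∀ {i} → i ≢ 0 → i ≢ k → Apart i 0
  apart-0 i≢0 i≢k = apart (λ i≡0 → contradiction i≡0 i≢0) (λ (i≡0 , _) → i≢0 i≡0) (λ (i≡k , _) → i≢k i≡k)

  apart-suc : ∀ {i j} → Apart i j → Apart (suc i) (suc j)
  apart-suc a = apart (λ e → ℕ.m<n⇒m<1+n (distinct a (ℕ.suc-injective e))) (λ ()) (λ ())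

  open Evasion {r S} δ Safe Tracks proj₁ follow Apart

  Forced : ℕ → Set
  Forced i = i ≡ 0 ⊎ i ≡ k

  forced? : ∀ i → Dec (Forced i)
  forced? i = (i ℕ.≟ 0) ⊎-dec (i ℕ.≟ k)

  free : ∀ {i} → ¬ Forced i → Safe i b0
  free f = f ∘ inj₁ , f ∘ inj₂

  apart-free : ∀ {i j} → Apart i j → Forced i → ¬ Forced j
  apart-free a (inj₁ refl) (inj₁ refl) = contradiction (distinct a refl) λ ()
  apart-free a (inj₁ refl) (inj₂ refl) = ¬0k a (refl , refl)
  apart-free a (inj₂ refl) (inj₁ refl) = ¬k0 a (refl , refl)
  apart-free a (inj₂ refl) (inj₂ refl) = ℕ.<-irrefl refl (distinct a refl)

  -- Here k ≥ 2 enters: for k = 1, the forced 1 after a 0 would lead to distance k while the other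
  -- candidate returns to 0.
  suc-forced≢k : ∀ {i} → Forced i → suc i ≢ k
  suc-forced≢k (inj₁ refl) refl = contradiction 2≤k λ { (s≤s ()) }
  suc-forced≢k (inj₂ refl) e = ℕ.1+n≢n e

  answer : ∀ {i j} → Apart i j → Answer i j
  answer {i} {j} a = inj₂ (tt , tt , apart-suc a) , diff-answer (forced? i) (forced? j) (suc i ℕ.≟ k)
    where
    diff-answer : Dec (Forced i) → Dec (Forced j) → Dec (suc i ≡ k) → Move i j b0 b1 ⊎ Move i j b1 b0
    diff-answer (yes fi) _ _ = inj₂ (tt , free (apart-free a fi) , apart-0 (λ ()) (suc-forced≢k fi))
    diff-answer (no ¬fi) (yes fj) _ = inj₁ (free ¬fi , tt , apart-sym (apart-0 (λ ()) (suc-forced≢k fj)))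
    diff-answer (no ¬fi) (no ¬fj) (no 1+i≢k) = inj₂ (tt , free ¬fj , apart-0 (λ ()) 1+i≢k)
    -- A 1 for `i` would give the bad distances k and 0, so `i` takes the 0. Then `suc j` is not k,
    -- since otherwise both distances would equal k - 1, against `distinct`.
    diff-answer (no ¬fi) (no ¬fj) (yes refl) = inj₁ (free ¬fi , tt ,
      apart-sym (apart-0 (λ ()) λ e → ℕ.<-asym (distinct a (sym (ℕ.suc-injective e))) (ℕ.n<1+n i)))

  gaps-evade : ¬ Wins₂ (r S) [] []
  gaps-evade = evade answer
    (apart (λ _ → ℕ.n<1+n k) (λ ()) (λ (e , _) → ℕ.1+n≢n e)) initial initial
    where
    initial : Tracks [] (suc k)
    initial = from-yes (¬? (sub? (b0 ∷ b0 ∷ []) [])) ∷ (λ { ([] , _ , ()) ; (_ ∷ _ , _ , ()) }) ∷ [] , refl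

00-factor : ∀ {s} → s ∈ zeroList → Sub (b0 ∷ b0 ∷ []) s
00-factor (here refl) = sub-refl
00-factor (there (here refl)) = [] , b1 ∷ [] , refl
00-factor (there (there (here refl))) = b1 ∷ [] , [] , refl

gap-evade : ∀ {s t k} → s ∈ zeroList → k ≡ 0 ⊎ 2 ≤ k → Sub (gapWord k) t → ¬ Wins₂ (r (s ∷ t ∷ [])) [] []
gap-evade {s} {t} s∈ (inj₁ refl) 00⊑t =
  -- For k = 0 both words contain 00, so any admissible gap length serves; 2 is the least.
  Gaps.gaps-evade 2 ℕ.≤-refl ∘ wins₂-mono (r-mono (here (00-factor s∈) ∷ here 00⊑t ∷ []))
gap-evade {k = k} s∈ (inj₂ 2≤k) h =
  Gaps.gaps-evade k 2≤k ∘ wins₂-mono (r-mono (here (00-factor s∈) ∷ there (here h) ∷ []))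

R#-or-evade : ∀ {s t} → s ∈ zeroList → Wins₂ (r (s ∷ t ∷ [])) [] [] → R# t
R#-or-evade s∈ w k k≢1 h = gap-evade s∈ k≢1 h w

wins⇒CondC : ∀ {s t} → s ∈ zeroList ⊎ s ∈ oneList → Wins₂ (r (s ∷ t ∷ [])) [] [] → CondCOrdered s t
wins⇒CondC (inj₁ s∈) w = inj₁ (s∈ , R#-or-evade s∈ w)
wins⇒CondC (inj₂ s∈) w = inj₂ (s∈ , R#-or-evade (flip-oneList s∈) (wins₂-flip w))

-- Classification of pairs of words

module Trie (Stop Leaf : Str → Set) (stop? : ∀ t → Dec (Stop t)) (leaf? : ∀ t → Dec (Leaf t)) where

  -- A finite certificate for a property of all words: `stop` settles a word with all its
  -- extensions, while `branch` settles the word alone and passes to its two children.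
  data Trie : ℕ → Str → Set where
    stop : ∀ {n t} → Stop t → Trie n t
    branch : ∀ {n t} → Leaf t → Trie n (t ∷ʳ b0) → Trie n (t ∷ʳ b1) → Trie (suc n) t

  trie? : ∀ n t → Dec (Trie n t)
  trie? zero t = map′ stop (λ { (stop h) → h }) (stop? t)
  trie? (suc n) t =
    map′ [ stop , (λ (l , h₀ , h₁) → branch l h₀ h₁) ]′
      (λ { (stop h) → inj₁ h ; (branch l h₀ h₁) → inj₂ (l , h₀ , h₁) })
      (stop? t ⊎-dec leaf? t ×-dec trie? n (t ∷ʳ b0) ×-dec trie? n (t ∷ʳ b1))

  module _ {P : Str → Set} (stopped : ∀ {t s} → Stop t → Prefix t s → P s) (leaf : ∀ {t} → Leaf t → P t) where

    descend : ∀ {n t} u → Trie n t → P (t ++ u)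
    descend u (stop h) = stopped h (u , refl)
    descend {t = t} [] (branch l _ _) = subst P (sym (++-identityʳ t)) (leaf l)
    descend {t = t} (b0 ∷ u) (branch _ h _) = subst P (++-assoc t _ u) (descend u h)
    descend {t = t} (b1 ∷ u) (branch _ _ h) = subst P (++-assoc t _ u) (descend u h)

-- Words for which (a) or (c) decides whatever the partner is. The empty word is included because it
-- is the root of every trie; nonemptiness excludes it afterwards.
special : List Str
special = [] ∷ shortList ++ zeroList ++ oneList

Covered : Str → Str → Set
Covered s t = Any (λ p → Covers (pairOf p) (s ∷ t ∷ [])) minimalPairs

Classified : Str → Str → Set
Classified s t = (s ∈ special ⊎ t ∈ special) ⊎ CondB s t ⊎ Covered s t

covered-prefix : ∀ {s s′ t t′} → Prefix s s′ → Prefix t t′ → Covered s t → Covered s′ t′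
covered-prefix hs ht = Any.map λ { (ds ∷ dt ∷ []) → extend hs ds ∷ extend ht dt ∷ [] }
  where
  extend : ∀ {S x w} → Prefix x w → Dead S x → Dead S w
  extend h = Any.map (λ s⊑x → sub-trans s⊑x (prefix⇒sub h))

covered? : ∀ s t → Dec (Covered s t)
covered? s t = any? (λ p → covers? (pairOf p) (s ∷ t ∷ [])) minimalPairs

open DecMembership _≟ˢ_ using () renaming (_∈?_ to _∈ˢ?_)
open DecMembership (×-≡-dec _≟ˢ_ _≟ˢ_) using () renaming (_∈?_ to _∈ᵖ?_)

condB? : ∀ s t → Dec (CondB s t)
condB? s t = ((s , t) ∈ᵖ? exceptional) ⊎-dec ((t , s) ∈ᵖ? exceptional)

-- `Open s` must serve all extensions of `s`, so it uses only criteria that they inherit; `Closed s`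
-- serves `s` alone and may also use the exceptional list.
module Open s = Trie (Covered s) (λ t → t ∈ special ⊎ Covered s t)
  (covered? s) (λ t → (t ∈ˢ? special) ⊎-dec covered? s t)

module Closed s = Trie (Covered s) (λ t → t ∈ special ⊎ CondB s t ⊎ Covered s t)
  (covered? s) (λ t → (t ∈ˢ? special) ⊎-dec condB? s t ⊎-dec covered? s t)

module Rows = Trie (λ s → Open.Trie s 6 []) (λ s → s ∈ special ⊎ Closed.Trie s 6 [])
  (λ s → Open.trie? s 6 []) (λ s → (s ∈ˢ? special) ⊎-dec Closed.trie? s 6 [])

abstract
  rows : Rows.Trie 6 []
  rows = from-yes (Rows.trie? 6 [])

classify : ∀ s t → Classified s t
classify s = Rows.descend {λ s → ∀ t → Classified s t} open-row
    [ (λ s∈ t → inj₁ (inj₁ s∈)) , closed-row ]′ s rows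
  where
  prefix-refl : ∀ {s} → Prefix s s
  prefix-refl {s} = [] , ++-identityʳ s
  open-row : ∀ {s s′} → Open.Trie s 6 [] → Prefix s s′ → ∀ t → Classified s′ t
  open-row {s} {s′} row hs t = Open.descend s {Classified s′}
    (λ c ht → inj₂ (inj₂ (covered-prefix hs ht c)))
    [ inj₁ ∘ inj₂ , inj₂ ∘ inj₂ ∘ covered-prefix hs prefix-refl ]′ t row
  closed-row : ∀ {s} → Closed.Trie s 6 [] → ∀ t → Classified s t
  closed-row {s} row t = Closed.descend s {Classified s}
    (λ c ht → inj₂ (inj₂ (covered-prefix prefix-refl ht c)))
    [ inj₁ ∘ inj₂ , inj₂ ]′ t row

-- The equivalence

special⁻ : ∀ {s} → s ≢ [] → s ∈ special → s ∈ shortList ⊎ s ∈ zeroList ⊎ s ∈ oneList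
special⁻ s≢[] (here s≡[]) = contradiction s≡[] s≢[]
special⁻ s≢[] (there s∈) = Sum.map₂ (∈-++⁻ zeroList) (∈-++⁻ shortList s∈)

covered-evades : ∀ {s t} → Covered s t → ¬ Wins₂ (r (s ∷ t ∷ [])) [] []
covered-evades c w = let (_ , p∈ , cov) = find c in minimalPairs-evade p∈ (wins₂-mono (r-mono cov) w)

wins⇒conditions : ∀ {s t} → s ≢ [] → t ≢ [] → Wins₂ (r (s ∷ t ∷ [])) [] [] →
  CondA s t ⊎ CondB s t ⊎ CondC s t
wins⇒conditions {s} {t} s≢[] t≢[] w = conditions (classify s t)
  where
  conditions : Classified s t → CondA s t ⊎ CondB s t ⊎ CondC s t
  conditions (inj₁ (inj₁ s∈)) =
    Sum.map inj₁ (λ s∈′ → inj₂ (inj₁ (wins⇒CondC s∈′ w))) (special⁻ s≢[] s∈)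
  conditions (inj₁ (inj₂ t∈)) =
    Sum.map inj₂ (λ t∈′ → inj₂ (inj₂ (wins⇒CondC t∈′ (wins₂-swap w)))) (special⁻ t≢[] t∈)
  conditions (inj₂ (inj₁ b)) = inj₂ (inj₁ b)
  conditions (inj₂ (inj₂ c)) = contradiction w (covered-evades c)

conditions⇒wins : ∀ {s t} → CondA s t ⊎ CondB s t ⊎ CondC s t → Wins₂ (r (s ∷ t ∷ [])) [] []
conditions⇒wins (inj₁ a) = short-wins a
conditions⇒wins (inj₂ (inj₁ (inj₁ st∈))) = exceptional-wins st∈
conditions⇒wins (inj₂ (inj₁ (inj₂ ts∈))) = wins₂-swap (exceptional-wins ts∈)
conditions⇒wins (inj₂ (inj₂ (inj₁ c))) = CondC-wins c
conditions⇒wins (inj₂ (inj₂ (inj₂ c))) = wins₂-swap (CondC-wins c)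

theorem8 : (s₁ s₂ : Str) → ¬ (s₁ ≡ []) → ¬ (s₂ ≡ []) → ¬ (s₁ ≡ s₂) →
    SeekerWins (r (s₁ ∷ s₂ ∷ [])) ⇔ (CondA s₁ s₂ ⊎ CondB s₁ s₂ ⊎ CondC s₁ s₂)
theorem8 s₁ s₂ s₁≢[] s₂≢[] _ = mk⇔
  (wins⇒conditions s₁≢[] s₂≢[] ∘ seeker⇒wins₂)
  (wins₂⇒seeker ∘ conditions⇒wins)
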